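{- Let $K$ be a subfield of $\mathbb{C}$ and let $(A_1,\ldots,A_p)$ be a tuple of $p$ arbitrary matrices of $M_n(K)$. Let $T \in K^{n\times n\times p}$ be the tensor with $z$-slices $A_1,\ldots,A_p$. Then the matrices $A_1,\ldots,A_p$ can be embedded as submatrices in a commuting tuple of $p$ diagonalizable matrices of size $\operatorname{rank}(T)+n$; that is, there exist pairwise commuting matrices $Z_1,\ldots,Z_p \in M_{\operatorname{rank}(T)+n}(K)$, each diagonalizable over $K$, such that $(Z_k)_{ij}=(A_k)_{ij}$ for all $1\le i,j\le n$ and $1\le k\le p$.
   Context: A tensor of format $m\times n\times p$ over a field $K$ is an array $T=(T_{ijk})\in K^{m\times n\times p}$. Its $k$-th $z$-slice is the $m\times n$ matrix $(T_{ijk})_{i,j}$, for $1 \le k\le p$. For $u\in K^m$, $v\in K^n$, $w\in K^p$, the tensor $u\otimes v\otimes w$ has entries $u_iv_jw_k$; it has rank one if $u,v,w\neq 0$. The rank over $K$, $\operatorname{rank}(T)$, is the smallest $r$ such that $T$ is a sum of $r$ rank-one tensors over $K$ (with $\operatorname{rank}(0)=0$). $M_n(K)$ is the set of $n\times n$ matrices over $K$. A matrix $Z_k$ is embedded as a submatrix in $Z'_k$ if it appears in the top-left corner of $Z'_k$. -}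

module Defs where

open import Level using (Level; _⊔_; suc; 0ℓ)
open import Algebra.Bundles using (CommutativeRing; RawRing)
open import Algebra.Structures using (IsCommutativeRing)
open import Algebra.Morphism.Structures using (IsRingMonomorphism)
import Algebra.Morphism.RingMonomorphism as RingMonomorphism
import Algebra.Properties.CommutativeMonoid.Sum as Sum
open import Data.Bool.Base using (if_then_else_)
open import Data.Fin.Base using (Fin; inject≤)
open import Data.Fin.Properties using (_≟_)
open import Data.Nat.Base as ℕ using (ℕ)
import Data.Nat.Properties as ℕ
open import Data.Product.Base using (Σ; ∃; ∃₂; _×_; _,_; proj₁; proj₂)
open import Data.Rational.Base as ℚ using (ℚ; 0ℚ; 1ℚ; ½; ∣_∣)
import Data.Rational.Properties as ℚ
open import Data.Rational.Solver using (module +-*-Solver)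
open import Data.Vec.Functional using (Vector)
open import Function.Base using (id)
open import Relation.Binary.PropositionalEquality
  using (_≡_; _≢_; refl; sym; trans; cong; subst)
open import Relation.Nullary using (¬_; does)

-- Real numbers: Cauchy sequences of rationals (with a modulus of
-- convergence), two sequences being identified when their difference
-- tends to zero.

Close : ℚ → ℚ → ℚ → Set
Close ε a b = ∣ a ℚ.- b ∣ ℚ.< ε

IsCauchy : (ℕ → ℚ) → Set
IsCauchy f = ∀ ε → 0ℚ ℚ.< ε →
  ∃ λ N → ∀ m n → N ℕ.≤ m → N ℕ.≤ n → Close ε (f m) (f n)

record ℝ : Set where
  constructor mkℝ
  field
    seq    : ℕ → ℚ
    cauchy : IsCauchy seq

open ℝ

infix 4 _≈ℝ_

_≈ℝ_ : ℝ → ℝ → Set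
x ≈ℝ y = ∀ ε → 0ℚ ℚ.< ε →
  ∃ λ N → ∀ n → N ℕ.≤ n → Close ε (seq x n) (seq y n)

private

  half-pos : ∀ {ε} → 0ℚ ℚ.< ε → 0ℚ ℚ.< ε ℚ.* ½
  half-pos {ε} 0<ε =
    ℚ.positive⁻¹ _ {{ℚ.pos*pos⇒pos ε {{ℚ.positive 0<ε}} ½}}

  half+half : ∀ ε → ε ℚ.* ½ ℚ.+ ε ℚ.* ½ ≡ ε
  half+half ε = trans (sym (ℚ.*-distribˡ-+ ε ½ ½)) (ℚ.*-identityʳ ε)

  close-refl : ∀ {ε} a → 0ℚ ℚ.< ε → Close ε a a
  close-refl {ε} a 0<ε = subst (λ t → ∣ t ∣ ℚ.< ε) (sym (ℚ.+-inverseʳ a)) 0<ε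

  close-≡ : ∀ {ε a b} → 0ℚ ℚ.< ε → a ≡ b → Close ε a b
  close-≡ {a = a} 0<ε refl = close-refl a 0<ε

  close-sym : ∀ {ε} a b → Close ε a b → Close ε b a
  close-sym {ε} a b = subst (ℚ._< ε) (trans (sym (ℚ.∣-p∣≡∣p∣ (a ℚ.- b))) (cong ∣_∣ lem))
    where
    lem : ℚ.- (a ℚ.- b) ≡ b ℚ.- a
    lem = solve 2 (λ a b → :- (a :- b) := b :- a) refl a b
      where open +-*-Solver

  sum-small : ∀ {ε δ} p q → ∣ p ∣ ℚ.< ε → ∣ q ∣ ℚ.< δ → ∣ p ℚ.+ q ∣ ℚ.< ε ℚ.+ δ
  sum-small p q p< q< = ℚ.≤-<-trans (ℚ.∣p+q∣≤∣p∣+∣q∣ p q) (ℚ.+-mono-< p< q<)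

  halves-small : ∀ {ε} p q → ∣ p ∣ ℚ.< ε ℚ.* ½ → ∣ q ∣ ℚ.< ε ℚ.* ½ → ∣ p ℚ.+ q ∣ ℚ.< ε
  halves-small {ε} p q p< q< =
    subst (∣ p ℚ.+ q ∣ ℚ.<_) (half+half ε) (sum-small p q p< q<)

  close-trans : ∀ {ε} a b c → Close (ε ℚ.* ½) a b → Close (ε ℚ.* ½) b c → Close ε a c
  close-trans {ε} a b c ab bc =
    subst (λ t → ∣ t ∣ ℚ.< ε) lem (halves-small (a ℚ.- b) (b ℚ.- c) ab bc)
    where
    lem : (a ℚ.- b) ℚ.+ (b ℚ.- c) ≡ a ℚ.- c
    lem = solve 3 (λ a b c → (a :- b) :+ (b :- c) := a :- c) refl a b c
      where open +-*-Solver

  close-+ : ∀ {ε} a b c d → Close (ε ℚ.* ½) a c → Close (ε ℚ.* ½) b d →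
            Close ε (a ℚ.+ b) (c ℚ.+ d)
  close-+ {ε} a b c d ac bd =
    subst (λ t → ∣ t ∣ ℚ.< ε) lem (halves-small (a ℚ.- c) (b ℚ.- d) ac bd)
    where
    lem : (a ℚ.- c) ℚ.+ (b ℚ.- d) ≡ (a ℚ.+ b) ℚ.- (c ℚ.+ d)
    lem = solve 4 (λ a b c d → (a :- c) :+ (b :- d) := (a :+ b) :- (c :+ d)) refl a b c d
      where open +-*-Solver

  close-neg : ∀ {ε} a b → Close ε a b → Close ε (ℚ.- a) (ℚ.- b)
  close-neg {ε} a b ab = subst (λ t → ∣ t ∣ ℚ.< ε) lem (close-sym a b ab)
    where
    lem : b ℚ.- a ≡ (ℚ.- a) ℚ.- (ℚ.- b)
    lem = solve 2 (λ a b → b :- a := (:- a) :- (:- b)) refl a b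
      where open +-*-Solver

  close-* : ∀ {ε B} → 0ℚ ℚ.< ε → 0ℚ ℚ.< B →
            ∃ λ δ → 0ℚ ℚ.< δ × (∀ a b c d → ∣ a ∣ ℚ.< B → ∣ d ∣ ℚ.< B →
              Close δ a c → Close δ b d → Close ε (a ℚ.* b) (c ℚ.* d))
  close-* {ε} {B} 0<ε 0<B = δ , 0<δ , bound
    where
    instance
      B-pos : ℚ.Positive B
      B-pos = ℚ.positive 0<B
      B-nonNeg : ℚ.NonNegative B
      B-nonNeg = ℚ.pos⇒nonNeg B
      B-nonZero : ℚ.NonZero B
      B-nonZero = ℚ.pos⇒nonZero B
    δ : ℚ
    δ = (ℚ.1/ B) ℚ.* (ε ℚ.* ½)
    0<δ : 0ℚ ℚ.< δ
    0<δ = ℚ.positive⁻¹ δ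
      {{ℚ.pos*pos⇒pos (ℚ.1/ B) {{ℚ.1/pos⇒pos B}} (ε ℚ.* ½) {{ℚ.positive (half-pos 0<ε)}}}}
    Bδ : B ℚ.* δ ≡ ε ℚ.* ½
    Bδ = trans (sym (ℚ.*-assoc B (ℚ.1/ B) (ε ℚ.* ½)))
      (trans (cong (ℚ._* (ε ℚ.* ½)) (ℚ.*-inverseʳ B)) (ℚ.*-identityˡ _))
    prod : ∀ p q → ∣ p ∣ ℚ.< B → ∣ q ∣ ℚ.< δ → ∣ p ℚ.* q ∣ ℚ.< ε ℚ.* ½
    prod p q p<B q<δ = begin-strict
      ∣ p ℚ.* q ∣      ≡⟨ ℚ.∣p*q∣≡∣p∣*∣q∣ p q ⟩
      ∣ p ∣ ℚ.* ∣ q ∣  ≤⟨ ℚ.*-monoʳ-≤-nonNeg ∣ q ∣ {{ℚ.nonNegative (ℚ.0≤∣p∣ q)}} (ℚ.<⇒≤ p<B) ⟩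
      B ℚ.* ∣ q ∣      <⟨ ℚ.*-monoʳ-<-pos B q<δ ⟩
      B ℚ.* δ          ≡⟨ Bδ ⟩
      ε ℚ.* ½          ∎
      where open ℚ.≤-Reasoning
    bound : ∀ a b c d → ∣ a ∣ ℚ.< B → ∣ d ∣ ℚ.< B →
            Close δ a c → Close δ b d → Close ε (a ℚ.* b) (c ℚ.* d)
    bound a b c d a<B d<B ac bd = subst (λ t → ∣ t ∣ ℚ.< ε) lem
      (halves-small (a ℚ.* (b ℚ.- d)) (d ℚ.* (a ℚ.- c))
        (prod a (b ℚ.- d) a<B bd) (prod d (a ℚ.- c) d<B ac))
      where
      lem : a ℚ.* (b ℚ.- d) ℚ.+ d ℚ.* (a ℚ.- c) ≡ a ℚ.* b ℚ.- c ℚ.* d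
      lem = solve 4 (λ a b c d →
        a :* (b :- d) :+ d :* (a :- c) := a :* b :- c :* d) refl a b c d
        where open +-*-Solver

  close-bound : ∀ {u} a c → Close u a c → ∣ a ∣ ℚ.< u ℚ.+ ∣ c ∣
  close-bound {u} a c ac = subst (λ t → ∣ t ∣ ℚ.< u ℚ.+ ∣ c ∣) lem
    (ℚ.≤-<-trans (ℚ.∣p+q∣≤∣p∣+∣q∣ (a ℚ.- c) c) (ℚ.+-monoˡ-< ∣ c ∣ ac))
    where
    lem : (a ℚ.- c) ℚ.+ c ≡ a
    lem = solve 2 (λ a c → (a :- c) :+ c := a) refl a c
      where open +-*-Solver

  Bounded : (ℕ → ℚ) → Set
  Bounded f = ∃₂ λ N B → 0ℚ ℚ.< B × (∀ n → N ℕ.≤ n → ∣ f n ∣ ℚ.< B)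

  cauchy⇒bounded : ∀ {u} f → 0ℚ ℚ.< u → IsCauchy f → Bounded f
  cauchy⇒bounded {u} f 0<u cf =
    let N , h = cf u 0<u
    in N , u ℚ.+ ∣ f N ∣ , ℚ.+-mono-<-≤ 0<u (ℚ.0≤∣p∣ (f N)) ,
      λ n N≤n → close-bound (f n) (f N) (h n N N≤n ℕ.≤-refl)

  bounded : ∀ x → Bounded (seq x)
  bounded x = cauchy⇒bounded (seq x) (ℚ.positive⁻¹ 1ℚ) (cauchy x)

  <-+ʳ : ∀ {p a b} → p ℚ.< a → 0ℚ ℚ.< b → p ℚ.< a ℚ.+ b
  <-+ʳ {p} {a} {b} p<a 0<b =
    subst (ℚ._< a ℚ.+ b) (ℚ.+-identityʳ p) (ℚ.+-mono-< p<a 0<b)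

  <-+ˡ : ∀ {p a b} → p ℚ.< b → 0ℚ ℚ.< a → p ℚ.< a ℚ.+ b
  <-+ˡ {p} {a} {b} p<b 0<a =
    subst (ℚ._< a ℚ.+ b) (ℚ.+-identityˡ p) (ℚ.+-mono-< 0<a p<b)

  bounded₂ : ∀ x y → ∃₂ λ N B → 0ℚ ℚ.< B ×
    (∀ n → N ℕ.≤ n → ∣ seq x n ∣ ℚ.< B × ∣ seq y n ∣ ℚ.< B)
  bounded₂ x y =
    let M , A , 0<A , f = bounded x
        N , B , 0<B , g = bounded y
    in M ℕ.⊔ N , A ℚ.+ B , <-+ʳ 0<A 0<B , λ n h →
      <-+ʳ (f n (ℕ.m⊔n≤o⇒m≤o M N h)) 0<B ,
      <-+ˡ (g n (ℕ.m⊔n≤o⇒n≤o M N h)) 0<A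

fromℚ : ℚ → ℝ
fromℚ q = mkℝ (λ _ → q) λ ε 0<ε → 0 , λ _ _ _ _ → close-refl q 0<ε

infixl 6 _+ℝ_
infixl 7 _*ℝ_
infix  8 -ℝ_

_+ℝ_ : ℝ → ℝ → ℝ
x +ℝ y = mkℝ (λ n → seq x n ℚ.+ seq y n) λ ε 0<ε →
  let M , f = cauchy x (ε ℚ.* ½) (half-pos 0<ε)
      N , g = cauchy y (ε ℚ.* ½) (half-pos 0<ε)
  in M ℕ.⊔ N , λ m n h k → close-+ (seq x m) (seq y m) (seq x n) (seq y n)
    (f m n (ℕ.m⊔n≤o⇒m≤o M N h) (ℕ.m⊔n≤o⇒m≤o M N k))
    (g m n (ℕ.m⊔n≤o⇒n≤o M N h) (ℕ.m⊔n≤o⇒n≤o M N k))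

-ℝ_ : ℝ → ℝ
-ℝ x = mkℝ (λ n → ℚ.- seq x n) λ ε 0<ε →
  let N , f = cauchy x ε 0<ε
  in N , λ m n h k → close-neg (seq x m) (seq x n) (f m n h k)

_*ℝ_ : ℝ → ℝ → ℝ
x *ℝ y = mkℝ (λ n → seq x n ℚ.* seq y n) λ ε 0<ε →
  let L , B , 0<B , b = bounded₂ x y
      δ , 0<δ , close = close-* 0<ε 0<B
      M , f = cauchy x δ 0<δ
      N , g = cauchy y δ 0<δ
      O     = L ℕ.⊔ (M ℕ.⊔ N)
  in O , λ m n h k →
    let h′ = ℕ.m⊔n≤o⇒n≤o L (M ℕ.⊔ N) h
        k′ = ℕ.m⊔n≤o⇒n≤o L (M ℕ.⊔ N) k
    in close (seq x m) (seq y m) (seq x n) (seq y n)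
      (proj₁ (b m (ℕ.m⊔n≤o⇒m≤o L (M ℕ.⊔ N) h)))
      (proj₂ (b n (ℕ.m⊔n≤o⇒m≤o L (M ℕ.⊔ N) k)))
      (f m n (ℕ.m⊔n≤o⇒m≤o M N h′) (ℕ.m⊔n≤o⇒m≤o M N k′))
      (g m n (ℕ.m⊔n≤o⇒n≤o M N h′) (ℕ.m⊔n≤o⇒n≤o M N k′))

private

  pointwise : ∀ {x y} → (∀ n → seq x n ≡ seq y n) → x ≈ℝ y
  pointwise eq ε 0<ε = 0 , λ n _ → close-≡ 0<ε (eq n)

  ≈ℝ-sym : ∀ {x y} → x ≈ℝ y → y ≈ℝ x
  ≈ℝ-sym {x} {y} p ε 0<ε =
    let N , f = p ε 0<ε in N , λ n h → close-sym (seq x n) (seq y n) (f n h)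

  ≈ℝ-trans : ∀ {x y z} → x ≈ℝ y → y ≈ℝ z → x ≈ℝ z
  ≈ℝ-trans {x} {y} {z} p q ε 0<ε =
    let M , f = p (ε ℚ.* ½) (half-pos 0<ε)
        N , g = q (ε ℚ.* ½) (half-pos 0<ε)
    in M ℕ.⊔ N , λ n h → close-trans (seq x n) (seq y n) (seq z n)
      (f n (ℕ.m⊔n≤o⇒m≤o M N h)) (g n (ℕ.m⊔n≤o⇒n≤o M N h))

  +ℝ-cong : ∀ {x y u v} → x ≈ℝ y → u ≈ℝ v → (x +ℝ u) ≈ℝ (y +ℝ v)
  +ℝ-cong {x} {y} {u} {v} p q ε 0<ε =
    let M , f = p (ε ℚ.* ½) (half-pos 0<ε)
        N , g = q (ε ℚ.* ½) (half-pos 0<ε)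
    in M ℕ.⊔ N , λ n h → close-+ (seq x n) (seq u n) (seq y n) (seq v n)
      (f n (ℕ.m⊔n≤o⇒m≤o M N h)) (g n (ℕ.m⊔n≤o⇒n≤o M N h))

  -ℝ-cong : ∀ {x y} → x ≈ℝ y → (-ℝ x) ≈ℝ (-ℝ y)
  -ℝ-cong {x} {y} p ε 0<ε =
    let N , f = p ε 0<ε in N , λ n h → close-neg (seq x n) (seq y n) (f n h)

  *ℝ-cong : ∀ {x y u v} → x ≈ℝ y → u ≈ℝ v → (x *ℝ u) ≈ℝ (y *ℝ v)
  *ℝ-cong {x} {y} {u} {v} p q ε 0<ε =
    let L , B , 0<B , b = bounded₂ x v
        δ , 0<δ , close = close-* 0<ε 0<B
        M , f = p δ 0<δ
        N , g = q δ 0<δ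
    in L ℕ.⊔ (M ℕ.⊔ N) , λ n h →
      let h′ = ℕ.m⊔n≤o⇒n≤o L (M ℕ.⊔ N) h
          bx , bv = b n (ℕ.m⊔n≤o⇒m≤o L (M ℕ.⊔ N) h)
      in close (seq x n) (seq u n) (seq y n) (seq v n) bx bv
        (f n (ℕ.m⊔n≤o⇒m≤o M N h′)) (g n (ℕ.m⊔n≤o⇒n≤o M N h′))

  ℝ-isCommutativeRing :
    IsCommutativeRing _≈ℝ_ _+ℝ_ _*ℝ_ -ℝ_ (fromℚ 0ℚ) (fromℚ 1ℚ)
  ℝ-isCommutativeRing = record
    { isRing = record
      { +-isAbelianGroup = record
        { isGroup = record
          { isMonoid = record
            { isSemigroup = record
              { isMagma = record
                { isEquivalence = record
                  { refl  = λ {x} → pointwise {x} {x} (λ _ → refl)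
                  ; sym   = λ {x} {y} → ≈ℝ-sym {x} {y}
                  ; trans = λ {x} {y} {z} → ≈ℝ-trans {x} {y} {z}
                  }
                ; ∙-cong = λ {x} {y} {u} {v} → +ℝ-cong {x} {y} {u} {v}
                }
              ; assoc = λ x y z → pointwise {(x +ℝ y) +ℝ z} {x +ℝ (y +ℝ z)}
                  λ n → ℚ.+-assoc (seq x n) (seq y n) (seq z n)
              }
            ; identity =
                (λ x → pointwise {fromℚ 0ℚ +ℝ x} {x} λ n → ℚ.+-identityˡ (seq x n)) ,
                (λ x → pointwise {x +ℝ fromℚ 0ℚ} {x} λ n → ℚ.+-identityʳ (seq x n))
            }
          ; inverse =
              (λ x → pointwise {(-ℝ x) +ℝ x} {fromℚ 0ℚ} λ n → ℚ.+-inverseˡ (seq x n)) ,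
              (λ x → pointwise {x +ℝ (-ℝ x)} {fromℚ 0ℚ} λ n → ℚ.+-inverseʳ (seq x n))
          ; ⁻¹-cong = λ {x} {y} → -ℝ-cong {x} {y}
          }
        ; comm = λ x y → pointwise {x +ℝ y} {y +ℝ x} λ n → ℚ.+-comm (seq x n) (seq y n)
        }
      ; *-cong = λ {x} {y} {u} {v} → *ℝ-cong {x} {y} {u} {v}
      ; *-assoc = λ x y z → pointwise {(x *ℝ y) *ℝ z} {x *ℝ (y *ℝ z)}
          λ n → ℚ.*-assoc (seq x n) (seq y n) (seq z n)
      ; *-identity =
          (λ x → pointwise {fromℚ 1ℚ *ℝ x} {x} λ n → ℚ.*-identityˡ (seq x n)) ,
          (λ x → pointwise {x *ℝ fromℚ 1ℚ} {x} λ n → ℚ.*-identityʳ (seq x n))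
      ; distrib =
          (λ x y z → pointwise {x *ℝ (y +ℝ z)} {(x *ℝ y) +ℝ (x *ℝ z)}
            λ n → ℚ.*-distribˡ-+ (seq x n) (seq y n) (seq z n)) ,
          (λ x y z → pointwise {(y +ℝ z) *ℝ x} {(y *ℝ x) +ℝ (z *ℝ x)}
            λ n → ℚ.*-distribʳ-+ (seq x n) (seq y n) (seq z n))
      }
    ; *-comm = λ x y → pointwise {x *ℝ y} {y *ℝ x} λ n → ℚ.*-comm (seq x n) (seq y n)
    }

-- Complex numbers: the pair (a , b) stands for a + b i.

ℂ-rawRing : RawRing 0ℓ 0ℓ
ℂ-rawRing = record
  { Carrier = ℝ × ℝ
  ; _≈_ = λ (a , b) (c , d) → a ≈ℝ c × b ≈ℝ d
  ; _+_ = λ (a , b) (c , d) → a +ℝ c , b +ℝ d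
  ; _*_ = λ (a , b) (c , d) → a *ℝ c +ℝ -ℝ (b *ℝ d) , a *ℝ d +ℝ b *ℝ c
  ; -_  = λ (a , b) → -ℝ a , -ℝ b
  ; 0#  = fromℚ 0ℚ , fromℚ 0ℚ
  ; 1#  = fromℚ 1ℚ , fromℚ 0ℚ
  }

private

  module R = IsCommutativeRing ℝ-isCommutativeRing
  module C = RawRing ℂ-rawRing

  module Identities where

    open +-*-Solver

    assoc-re : ∀ a b c d e f →
      (a ℚ.* c ℚ.+ ℚ.- (b ℚ.* d)) ℚ.* e ℚ.+ ℚ.- ((a ℚ.* d ℚ.+ b ℚ.* c) ℚ.* f) ≡
      a ℚ.* (c ℚ.* e ℚ.+ ℚ.- (d ℚ.* f)) ℚ.+ ℚ.- (b ℚ.* (c ℚ.* f ℚ.+ d ℚ.* e))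
    assoc-re = solve 6 (λ a b c d e f →
      (a :* c :+ :- (b :* d)) :* e :+ :- ((a :* d :+ b :* c) :* f) :=
      a :* (c :* e :+ :- (d :* f)) :+ :- (b :* (c :* f :+ d :* e))) refl

    assoc-im : ∀ a b c d e f →
      (a ℚ.* c ℚ.+ ℚ.- (b ℚ.* d)) ℚ.* f ℚ.+ (a ℚ.* d ℚ.+ b ℚ.* c) ℚ.* e ≡
      a ℚ.* (c ℚ.* f ℚ.+ d ℚ.* e) ℚ.+ b ℚ.* (c ℚ.* e ℚ.+ ℚ.- (d ℚ.* f))
    assoc-im = solve 6 (λ a b c d e f →
      (a :* c :+ :- (b :* d)) :* f :+ (a :* d :+ b :* c) :* e :=
      a :* (c :* f :+ d :* e) :+ b :* (c :* e :+ :- (d :* f))) refl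

    id-re : ∀ a b → 1ℚ ℚ.* a ℚ.+ ℚ.- (0ℚ ℚ.* b) ≡ a
    id-re = solve 2 (λ a b → con 1ℚ :* a :+ :- (con 0ℚ :* b) := a) refl

    id-im : ∀ a b → 1ℚ ℚ.* b ℚ.+ 0ℚ ℚ.* a ≡ b
    id-im = solve 2 (λ a b → con 1ℚ :* b :+ con 0ℚ :* a := b) refl

    distrib-re : ∀ a b c d e f →
      a ℚ.* (c ℚ.+ e) ℚ.+ ℚ.- (b ℚ.* (d ℚ.+ f)) ≡
      (a ℚ.* c ℚ.+ ℚ.- (b ℚ.* d)) ℚ.+ (a ℚ.* e ℚ.+ ℚ.- (b ℚ.* f))
    distrib-re = solve 6 (λ a b c d e f →
      a :* (c :+ e) :+ :- (b :* (d :+ f)) :=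
      (a :* c :+ :- (b :* d)) :+ (a :* e :+ :- (b :* f))) refl

    distrib-im : ∀ a b c d e f →
      a ℚ.* (d ℚ.+ f) ℚ.+ b ℚ.* (c ℚ.+ e) ≡
      (a ℚ.* d ℚ.+ b ℚ.* c) ℚ.+ (a ℚ.* f ℚ.+ b ℚ.* e)
    distrib-im = solve 6 (λ a b c d e f →
      a :* (d :+ f) :+ b :* (c :+ e) :=
      (a :* d :+ b :* c) :+ (a :* f :+ b :* e)) refl

    comm-re : ∀ a b c d →
      a ℚ.* c ℚ.+ ℚ.- (b ℚ.* d) ≡ c ℚ.* a ℚ.+ ℚ.- (d ℚ.* b)
    comm-re = solve 4 (λ a b c d → a :* c :+ :- (b :* d) := c :* a :+ :- (d :* b)) refl

    comm-im : ∀ a b c d → a ℚ.* d ℚ.+ b ℚ.* c ≡ c ℚ.* b ℚ.+ d ℚ.* a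
    comm-im = solve 4 (λ a b c d → a :* d :+ b :* c := c :* b :+ d :* a) refl

  open Identities

  ≈ℂ-sym : ∀ {x y} → x C.≈ y → y C.≈ x
  ≈ℂ-sym {a , b} {c , d} (p , q) = ≈ℝ-sym {a} {c} p , ≈ℝ-sym {b} {d} q

  ≈ℂ-trans : ∀ {x y z} → x C.≈ y → y C.≈ z → x C.≈ z
  ≈ℂ-trans {a , b} {c , d} {e , f} (p , q) (s , t) =
    ≈ℝ-trans {a} {c} {e} p s , ≈ℝ-trans {b} {d} {f} q t

  +ℂ-cong : ∀ {x y u v} → x C.≈ y → u C.≈ v → (x C.+ u) C.≈ (y C.+ v)
  +ℂ-cong {a , b} {c , d} {e , f} {g , h} (p , q) (s , t) =
    +ℝ-cong {a} {c} {e} {g} p s , +ℝ-cong {b} {d} {f} {h} q t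

  -ℂ-cong : ∀ {x y} → x C.≈ y → (C.- x) C.≈ (C.- y)
  -ℂ-cong {a , b} {c , d} (p , q) = -ℝ-cong {a} {c} p , -ℝ-cong {b} {d} q

  *ℂ-cong : ∀ {x y u v} → x C.≈ y → u C.≈ v → (x C.* u) C.≈ (y C.* v)
  *ℂ-cong {a , b} {c , d} {e , f} {g , h} (p , q) (s , t) =
    +ℝ-cong {a *ℝ e} {c *ℝ g} { -ℝ (b *ℝ f)} { -ℝ (d *ℝ h)}
      (*ℝ-cong {a} {c} {e} {g} p s)
      (-ℝ-cong {b *ℝ f} {d *ℝ h} (*ℝ-cong {b} {d} {f} {h} q t)) ,
    +ℝ-cong {a *ℝ f} {c *ℝ h} {b *ℝ e} {d *ℝ g}
      (*ℝ-cong {a} {c} {f} {h} p t)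
      (*ℝ-cong {b} {d} {e} {g} q s)

  *ℂ-assoc : ∀ x y z → ((x C.* y) C.* z) C.≈ (x C.* (y C.* z))
  *ℂ-assoc x@(a , b) y@(c , d) z@(e , f) =
    pointwise {proj₁ ((x C.* y) C.* z)} {proj₁ (x C.* (y C.* z))} (λ n →
      assoc-re (seq a n) (seq b n) (seq c n) (seq d n) (seq e n) (seq f n)) ,
    pointwise {proj₂ ((x C.* y) C.* z)} {proj₂ (x C.* (y C.* z))} (λ n →
      assoc-im (seq a n) (seq b n) (seq c n) (seq d n) (seq e n) (seq f n))

  *ℂ-comm : ∀ x y → (x C.* y) C.≈ (y C.* x)
  *ℂ-comm x@(a , b) y@(c , d) =
    pointwise {proj₁ (x C.* y)} {proj₁ (y C.* x)} (λ n →
      comm-re (seq a n) (seq b n) (seq c n) (seq d n)) ,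
    pointwise {proj₂ (x C.* y)} {proj₂ (y C.* x)} (λ n →
      comm-im (seq a n) (seq b n) (seq c n) (seq d n))

  *ℂ-identityˡ : ∀ x → (C.1# C.* x) C.≈ x
  *ℂ-identityˡ x@(a , b) =
    pointwise {proj₁ (C.1# C.* x)} {a} (λ n → id-re (seq a n) (seq b n)) ,
    pointwise {proj₂ (C.1# C.* x)} {b} (λ n → id-im (seq a n) (seq b n))

  *ℂ-identityʳ : ∀ x → (x C.* C.1#) C.≈ x
  *ℂ-identityʳ x = ≈ℂ-trans {x C.* C.1#} {C.1# C.* x} {x}
    (*ℂ-comm x C.1#) (*ℂ-identityˡ x)

  *ℂ-distribˡ-+ : ∀ x y z → (x C.* (y C.+ z)) C.≈ ((x C.* y) C.+ (x C.* z))
  *ℂ-distribˡ-+ x@(a , b) y@(c , d) z@(e , f) =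
    pointwise {proj₁ (x C.* (y C.+ z))} {proj₁ ((x C.* y) C.+ (x C.* z))} (λ n →
      distrib-re (seq a n) (seq b n) (seq c n) (seq d n) (seq e n) (seq f n)) ,
    pointwise {proj₂ (x C.* (y C.+ z))} {proj₂ ((x C.* y) C.+ (x C.* z))} (λ n →
      distrib-im (seq a n) (seq b n) (seq c n) (seq d n) (seq e n) (seq f n))

  *ℂ-distribʳ-+ : ∀ x y z → ((y C.+ z) C.* x) C.≈ ((y C.* x) C.+ (z C.* x))
  *ℂ-distribʳ-+ x y z =
    ≈ℂ-trans {(y C.+ z) C.* x} {x C.* (y C.+ z)} {(y C.* x) C.+ (z C.* x)}
      (*ℂ-comm (y C.+ z) x)
      (≈ℂ-trans {x C.* (y C.+ z)} {(x C.* y) C.+ (x C.* z)} {(y C.* x) C.+ (z C.* x)}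
        (*ℂ-distribˡ-+ x y z)
        (+ℂ-cong {x C.* y} {y C.* x} {x C.* z} {z C.* x} (*ℂ-comm x y) (*ℂ-comm x z)))

  ℂ-isCommutativeRing : IsCommutativeRing C._≈_ C._+_ C._*_ C.-_ C.0# C.1#
  ℂ-isCommutativeRing = record
    { isRing = record
      { +-isAbelianGroup = record
        { isGroup = record
          { isMonoid = record
            { isSemigroup = record
              { isMagma = record
                { isEquivalence = record
                  { refl  = λ {(a , b)} → R.refl {a} , R.refl {b}
                  ; sym   = λ {x} {y} → ≈ℂ-sym {x} {y}
                  ; trans = λ {x} {y} {z} → ≈ℂ-trans {x} {y} {z}
                  }
                ; ∙-cong = λ {x} {y} {u} {v} → +ℂ-cong {x} {y} {u} {v}
                }
              ; assoc = λ (a , b) (c , d) (e , f) → R.+-assoc a c e , R.+-assoc b d f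
              }
            ; identity = (λ (a , b) → R.+-identityˡ a , R.+-identityˡ b) ,
                         (λ (a , b) → R.+-identityʳ a , R.+-identityʳ b)
            }
          ; inverse = (λ (a , b) → R.-‿inverseˡ a , R.-‿inverseˡ b) ,
                      (λ (a , b) → R.-‿inverseʳ a , R.-‿inverseʳ b)
          ; ⁻¹-cong = λ {x} {y} → -ℂ-cong {x} {y}
          }
        ; comm = λ (a , b) (c , d) → R.+-comm a c , R.+-comm b d
        }
      ; *-cong     = λ {x} {y} {u} {v} → *ℂ-cong {x} {y} {u} {v}
      ; *-assoc    = *ℂ-assoc
      ; *-identity = *ℂ-identityˡ , *ℂ-identityʳ
      ; distrib    = *ℂ-distribˡ-+ , *ℂ-distribʳ-+
      }
    ; *-comm = *ℂ-comm
    }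

-- Opaque only for the sake of the type checker: otherwise comparing types
-- over ℂ unfolds the arithmetic of ℚ.
opaque

  ℂ-commutativeRing : CommutativeRing 0ℓ 0ℓ
  ℂ-commutativeRing = record
    { RawRing ℂ-rawRing
    ; isCommutativeRing = ℂ-isCommutativeRing
    }

-- Subfields of a field F, as predicates on F.
record Subfield {c ℓ} (F : CommutativeRing c ℓ) (k : Level) : Set (c ⊔ ℓ ⊔ suc k) where

  private module F = CommutativeRing F

  field
    Member     : F.Carrier → Set k
    resp       : ∀ {x y} → x F.≈ y → Member x → Member y
    0-member   : Member F.0#
    1-member   : Member F.1#
    +-closed   : ∀ {x y} → Member x → Member y → Member (x F.+ y)
    *-closed   : ∀ {x y} → Member x → Member y → Member (x F.* y)
    neg-closed : ∀ {x} → Member x → Member (F.- x)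
    -- Stated for any y inverse to x, as inversion is not given as an
    -- operation on F.
    inv-closed : ∀ {x y} → x F.* y F.≈ F.1# → Member x → Member y

  rawRing : RawRing (c ⊔ k) ℓ
  rawRing = record
    { Carrier = Σ F.Carrier Member
    ; _≈_ = λ x y → proj₁ x F.≈ proj₁ y
    ; _+_ = λ (x , p) (y , q) → x F.+ y , +-closed p q
    ; _*_ = λ (x , p) (y , q) → x F.* y , *-closed p q
    ; -_  = λ (x , p) → F.- x , neg-closed p
    ; 0#  = F.0# , 0-member
    ; 1#  = F.1# , 1-member
    }

  commutativeRing : CommutativeRing (c ⊔ k) ℓ
  commutativeRing = record
    { RawRing rawRing
    ; isCommutativeRing =
        RingMonomorphism.isCommutativeRing isRingMonomorphism F.isCommutativeRing
    }
    where
    isRingMonomorphism : IsRingMonomorphism rawRing F.rawRing proj₁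
    isRingMonomorphism = record
      { isRingHomomorphism = record
        { isSemiringHomomorphism = record
          { isNearSemiringHomomorphism = record
            { +-isMonoidHomomorphism = record
              { isMagmaHomomorphism = record
                { isRelHomomorphism = record { cong = id }
                ; homo = λ _ _ → F.refl
                }
              ; ε-homo = F.refl
              }
            ; *-homo = λ _ _ → F.refl
            }
          ; 1#-homo = F.refl
          }
        ; -‿homo = λ _ → F.refl
        }
      ; injective = id
      }

module LinearAlgebra {c ℓ} (R : CommutativeRing c ℓ) where

  open CommutativeRing R
    using (Carrier; _≈_; _*_; 0#; 1#; +-commutativeMonoid)
  open Sum +-commutativeMonoid using (sum)

  Matrix : ℕ → ℕ → Set c
  Matrix m n = Vector (Vector Carrier n) m

  infix 4 _≋_
  infixl 7 _·_

  _≋_ : ∀ {m n} → Matrix m n → Matrix m n → Set ℓ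
  A ≋ B = ∀ i j → A i j ≈ B i j

  _·_ : ∀ {l m n} → Matrix l m → Matrix m n → Matrix l n
  (A · B) i k = sum λ j → A i j * B j k

  identity : ∀ n → Matrix n n
  identity n i j = if does (i ≟ j) then 1# else 0#

  Inverse : ∀ {n} → Matrix n n → Matrix n n → Set ℓ
  Inverse {n} P Q = P · Q ≋ identity n × Q · P ≋ identity n

  IsDiagonal : ∀ {n} → Matrix n n → Set ℓ
  IsDiagonal D = ∀ i j → i ≢ j → D i j ≈ 0#

  Diagonalizable : ∀ {n} → Matrix n n → Set (c ⊔ ℓ)
  Diagonalizable Z = ∃₂ λ P Q → ∃ λ D →
    Inverse P Q × IsDiagonal D × Z ≋ P · D · Q

  PairwiseCommuting : ∀ {n p} → Vector (Matrix n n) p → Set ℓ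
  PairwiseCommuting Z = ∀ k l → Z k · Z l ≋ Z l · Z k

  EmbeddedIn : ∀ {n N} → Matrix n n → Matrix N N → Set ℓ
  EmbeddedIn {n} {N} A Z = Σ (n ℕ.≤ N) λ n≤N →
    ∀ i j → Z (inject≤ i n≤N) (inject≤ j n≤N) ≈ A i j

  Tensor : ℕ → ℕ → ℕ → Set c
  Tensor m n p = Fin m → Fin n → Fin p → Carrier

  _≈ᵀ_ : ∀ {m n p} → Tensor m n p → Tensor m n p → Set ℓ
  S ≈ᵀ T = ∀ i j k → S i j k ≈ T i j k

  zSlice : ∀ {m n p} → Tensor m n p → Fin p → Matrix m n
  zSlice T k i j = T i j k

  _⊗_⊗_ : ∀ {m n p} → Vector Carrier m → Vector Carrier n → Vector Carrier p →
          Tensor m n p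
  (u ⊗ v ⊗ w) i j k = u i * v j * w k

  sumᵀ : ∀ {m n p r} → Vector (Tensor m n p) r → Tensor m n p
  sumᵀ S i j k = sum λ l → S l i j k

  NonZero : ∀ {n} → Vector Carrier n → Set ℓ
  NonZero u = ¬ (∀ i → u i ≈ 0#)

  RankOne : ∀ {m n p} → Tensor m n p → Set (c ⊔ ℓ)
  RankOne T = ∃₂ λ u v → ∃ λ w →
    NonZero u × NonZero v × NonZero w × T ≈ᵀ (u ⊗ v ⊗ w)

  SumOfRankOnes : ∀ {m n p} → Tensor m n p → ℕ → Set (c ⊔ ℓ)
  SumOfRankOnes {m} {n} {p} T r = Σ (Vector (Tensor m n p) r) λ S →
    (∀ l → RankOne (S l)) × T ≈ᵀ sumᵀ S

  -- The rank as a relation: "rank(T) = r".  A number r of this kind is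
  -- unique, but in general it cannot be computed from T.
  HasRank : ∀ {m n p} → Tensor m n p → ℕ → Set (c ⊔ ℓ)
  HasRank T r = SumOfRankOnes T r × (∀ s → SumOfRankOnes T s → r ℕ.≤ s)

{-# OPTIONS --safe #-}

-- If A_k = U D_k V with D_k diagonal of size r, for fixed U and V, it is enough
-- to find an invertible P of size n + r whose first n rows end with U and such
-- that the first n columns of P⁻¹ end with V: then the matrices
-- Z_k = P diag(0, D_k) P⁻¹ commute and have A_k in their top-left corner.
-- Such a P is a product of two block shears,
--   P = [I U; 0 I] [I 0; -V I],   P⁻¹ = [I 0; V I] [I -U; 0 I].
-- A decomposition of T into r rank-one tensors u ⊗ v ⊗ w provides U (columns u),
-- V (rows v) and D_k (entries w_k).

module Submission where

open import Defs
open import Algebra.Bundles using (CommutativeRing; Ring)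
import Algebra.Properties.Monoid as MonoidProperties
import Algebra.Properties.Ring as RingProperties
import Algebra.Properties.Semiring.Sum as SemiringSum
open import Data.Bool.Base using (if_then_else_)
open import Data.Fin.Base using (Fin; suc; inject≤; splitAt; punchIn; _↑ˡ_; _↑ʳ_)
open import Data.Fin.Properties
  using (_≟_; splitAt-↑ˡ; splitAt-↑ʳ; punchInᵢ≢i; toℕ-injective; toℕ-inject≤; toℕ-↑ˡ)
open import Data.Nat.Base using (ℕ; zero; suc; _+_)
import Data.Nat.Properties as ℕ
open import Data.Product.Base using (∃; _×_; _,_; proj₁; proj₂)
open import Data.Sum.Base using (_⊎_; inj₁; inj₂; [_,_])
open import Data.Vec.Functional using (Vector; removeAt; _++_; replicate)
open import Function.Base using (_∘_)
open import Relation.Binary.PropositionalEquality as ≡ using (_≡_; _≢_)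
import Relation.Binary.Reasoning.Setoid as SetoidReasoning
open import Relation.Nullary using (yes; no; does; contradiction)

-- Units and conjugation in a noncommutative ring.

module RingUnits {c ℓ} (R : Ring c ℓ) where

  open Ring R renaming (_+_ to _⊹_)
  open RingProperties R using (-‿distribˡ-*; -‿distribʳ-*; -0#≈0#)
  open MonoidProperties *-monoid using (cancelʳ; cancelˡ)
  open SetoidReasoning setoid

  -- The product expands to 1 + (x + y) + xy. Keeping `x` and `y` separate covers both orders of x
  -- and -x, which a noncommutative ring requires.
  1+-inverseʳ : ∀ {x y} → x * y ≈ 0# → x ⊹ y ≈ 0# → (1# ⊹ x) * (1# ⊹ y) ≈ 1#
  1+-inverseʳ {x} {y} xy≈0 x+y≈0 = begin
    (1# ⊹ x) * (1# ⊹ y)            ≈⟨ distribˡ _ _ _ ⟩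
    (1# ⊹ x) * 1# ⊹ (1# ⊹ x) * y   ≈⟨ +-cong (*-identityʳ _) (distribʳ _ _ _) ⟩
    (1# ⊹ x) ⊹ (1# * y ⊹ x * y)    ≈⟨ +-congˡ (+-cong (*-identityˡ y) xy≈0) ⟩
    (1# ⊹ x) ⊹ (y ⊹ 0#)            ≈⟨ +-congˡ (+-identityʳ y) ⟩
    (1# ⊹ x) ⊹ y                   ≈⟨ +-assoc _ _ _ ⟩
    1# ⊹ (x ⊹ y)                   ≈⟨ +-congˡ x+y≈0 ⟩
    1# ⊹ 0#                        ≈⟨ +-identityʳ 1# ⟩
    1#                             ∎

  module _ {x} (xx≈0 : x * x ≈ 0#) where

    [1+x][1-x]≈1 : (1# ⊹ x) * (1# ⊹ - x) ≈ 1#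
    [1+x][1-x]≈1 = 1+-inverseʳ
      (trans (sym (-‿distribʳ-* x x)) (trans (-‿cong xx≈0) -0#≈0#)) (-‿inverseʳ x)

    [1-x][1+x]≈1 : (1# ⊹ - x) * (1# ⊹ x) ≈ 1#
    [1-x][1+x]≈1 = 1+-inverseʳ
      (trans (sym (-‿distribˡ-* x x)) (trans (-‿cong xx≈0) -0#≈0#)) (-‿inverseˡ x)

  -- The inner pair `b * b′` cancels first. The claim is one-sided, so a two-sided inverse takes two
  -- applications.
  *-inverse : ∀ {a a′ b b′} → a * a′ ≈ 1# → b * b′ ≈ 1# → (a * b) * (b′ * a′) ≈ 1#
  *-inverse {a} {a′} {b} {b′} aa′ bb′ = begin
    (a * b) * (b′ * a′)  ≈⟨ *-assoc _ _ _ ⟩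
    a * (b * (b′ * a′))  ≈⟨ *-congˡ (cancelˡ bb′ a′) ⟩
    a * a′               ≈⟨ aa′ ⟩
    1#                   ∎

  -- The inner factor `q * p` cancels, so conjugation turns products into products.
  conjugates-commute : ∀ {p q x y} → q * p ≈ 1# → x * y ≈ y * x →
    (p * x * q) * (p * y * q) ≈ (p * y * q) * (p * x * q)
  conjugates-commute {p} {q} {x} {y} qp xy≈yx = begin
    (p * x * q) * (p * y * q)  ≈⟨ collapse x y ⟩
    p * (x * y) * q            ≈⟨ *-congʳ (*-congˡ xy≈yx) ⟩
    p * (y * x) * q            ≈⟨ collapse y x ⟨
    (p * y * q) * (p * x * q)  ∎
    where
    collapse : ∀ x y → (p * x * q) * (p * y * q) ≈ p * (x * y) * q
    collapse x y = begin
      (p * x * q) * (p * y * q)    ≈⟨ *-assoc _ _ _ ⟨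
      (p * x * q) * (p * y) * q    ≈⟨ *-congʳ (*-assoc _ _ _) ⟨
      (p * x * q) * p * y * q      ≈⟨ *-congʳ (*-congʳ (cancelʳ qp (p * x))) ⟩
      p * x * y * q                ≈⟨ *-congʳ (*-assoc _ _ _) ⟩
      p * (x * y) * q              ∎

-- Finite sums and diagonal matrices.

module Matrices {c ℓ} (R : CommutativeRing c ℓ) where

  open CommutativeRing R renaming (_+_ to _⊹_)
  open RingProperties ring using (-0#≈0#)
  open SemiringSum semiring
  open LinearAlgebra R
  open SetoidReasoning setoid

  sum-zero : ∀ {n} {f : Vector Carrier n} → (∀ i → f i ≈ 0#) → sum f ≈ 0#
  sum-zero {n} f≈0 = trans (sum-cong-≋ f≈0) (sum-replicate-zero n)

  sum-single : ∀ {n} (f : Vector Carrier n) i → (∀ j → j ≢ i → f j ≈ 0#) → sum f ≈ f i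
  sum-single {suc n} f i f≈0 = begin
    sum f                      ≈⟨ sum-remove {i = i} f ⟩
    f i ⊹ sum (removeAt f i)   ≈⟨ +-congˡ (sum-zero λ j → f≈0 (punchIn i j) (punchInᵢ≢i i j)) ⟩
    f i ⊹ 0#                   ≈⟨ +-identityʳ (f i) ⟩
    f i                        ∎

  sum-split : ∀ m {n} (f : Vector Carrier (m + n)) →
              sum f ≈ sum (λ i → f (i ↑ˡ n)) ⊹ sum (λ i → f (m ↑ʳ i))
  sum-split zero    f = sym (+-identityˡ _)
  sum-split (suc m) f = trans (+-congˡ (sum-split m (f ∘ suc))) (sym (+-assoc _ _ _))

  -- Same shape as `identity`, so `identity n` is definitionally the diagonal of the constant vector
  -- `1#`. The unit laws of the matrix ring and the off-diagonal zeros of the shears use this.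
  diagonal : ∀ {n} → Vector Carrier n → Matrix n n
  diagonal d i j = if does (i ≟ j) then d i else 0#

  diagonal-≡ : ∀ {n} (d : Vector Carrier n) i → diagonal d i i ≈ d i
  diagonal-≡ d i with i ≟ i
  ... | yes _  = refl
  ... | no i≢i = contradiction ≡.refl i≢i

  diagonal-≢ : ∀ {n} (d : Vector Carrier n) → IsDiagonal (diagonal d)
  diagonal-≢ d i j i≢j with i ≟ j
  ... | yes i≡j = contradiction i≡j i≢j
  ... | no  _   = refl

  ·-diagonal : ∀ {m n} (A : Matrix m n) d i k → (A · diagonal d) i k ≈ A i k * d k
  ·-diagonal A d i k = trans
    (sum-single _ k λ j j≢k → trans (*-congˡ (diagonal-≢ d j k j≢k)) (zeroʳ _))
    (*-congˡ (diagonal-≡ d k))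

  diagonal-· : ∀ {m n} d (A : Matrix m n) i k → (diagonal d · A) i k ≈ d i * A i k
  diagonal-· d A i k = trans
    (sum-single _ i λ j j≢i → trans (*-congʳ (diagonal-≢ d i j (j≢i ∘ ≡.sym))) (zeroˡ _))
    (*-congʳ (diagonal-≡ d i))

  diagonals-commute : ∀ {n} (d e : Vector Carrier n) →
                      diagonal d · diagonal e ≋ diagonal e · diagonal d
  diagonals-commute d e i k = begin
    (diagonal d · diagonal e) i k  ≈⟨ ·-diagonal (diagonal d) e i k ⟩
    diagonal d i k * e k           ≈⟨ *-comm _ _ ⟩
    e k * diagonal d i k           ≈⟨ swap ⟩
    e i * diagonal d i k           ≈⟨ diagonal-· e (diagonal d) i k ⟨
    (diagonal e · diagonal d) i k  ∎
    where
    -- `e k` and `e i` can differ only off the diagonal, where the other factor is zero.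
    swap : e k * diagonal d i k ≈ e i * diagonal d i k
    swap with i ≟ k
    ... | yes ≡.refl = refl
    ... | no _       = trans (zeroʳ _) (sym (zeroʳ _))

  -- The ring of square matrices.

  ·-assoc : ∀ {k l m n} (A : Matrix k l) (B : Matrix l m) (C : Matrix m n) →
            (A · B) · C ≋ A · (B · C)
  ·-assoc A B C i j = begin
    sum (λ b → sum (λ a → A i a * B a b) * C b j)
      ≈⟨ sum-cong-≋ (λ b → *-distribʳ-sum (C b j) (λ a → A i a * B a b)) ⟩
    sum (λ b → sum (λ a → A i a * B a b * C b j))
      -- Both products are the double sum of the terms `A i a * B a b * C b j`, taken in the two
      -- orders of summation.
      ≈⟨ ∑-comm (λ b a → A i a * B a b * C b j) ⟩
    sum (λ a → sum (λ b → A i a * B a b * C b j))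
      ≈⟨ sum-cong-≋ (λ a → sum-cong-≋ λ b → *-assoc (A i a) (B a b) (C b j)) ⟩
    sum (λ a → sum (λ b → A i a * (B a b * C b j)))
      ≈⟨ sum-cong-≋ (λ a → *-distribˡ-sum (A i a) (λ b → B a b * C b j)) ⟨
    sum (λ a → A i a * sum (λ b → B a b * C b j)) ∎

  -- Packaged as a `Ring` so that the results on units and conjugation apply to matrices.
  matrixRing : ℕ → Ring c ℓ
  matrixRing n = record
    { Carrier = Matrix n n
    ; _≈_ = _≋_
    ; _+_ = λ A B i j → A i j ⊹ B i j
    ; _*_ = _·_
    ; -_ = λ A i j → - A i j
    ; 0# = λ _ _ → 0#
    ; 1# = identity n
    ; isRing = record
      { +-isAbelianGroup = record
        { isGroup = record
          { isMonoid = record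
            { isSemigroup = record
              { isMagma = record
                { isEquivalence = record
                  { refl  = λ _ _ → refl
                  ; sym   = λ p i j → sym (p i j)
                  ; trans = λ p q i j → trans (p i j) (q i j)
                  }
                ; ∙-cong = λ p q i j → +-cong (p i j) (q i j)
                }
              ; assoc = λ A B C i j → +-assoc (A i j) (B i j) (C i j)
              }
            ; identity = (λ A i j → +-identityˡ (A i j)) , (λ A i j → +-identityʳ (A i j))
            }
          ; inverse = (λ A i j → -‿inverseˡ (A i j)) , (λ A i j → -‿inverseʳ (A i j))
          ; ⁻¹-cong = λ p i j → -‿cong (p i j)
          }
        ; comm = λ A B i j → +-comm (A i j) (B i j)
        }
      ; *-cong = λ p q i j → sum-cong-≋ λ a → *-cong (p i a) (q a j)
      ; *-assoc = ·-assoc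
      ; *-identity =
          (λ A i j → trans (diagonal-· (λ _ → 1#) A i j) (*-identityˡ (A i j))) ,
          (λ A i j → trans (·-diagonal A (λ _ → 1#) i j) (*-identityʳ (A i j)))
      ; distrib =
          (λ A B C i j → trans (sum-cong-≋ λ a → distribˡ (A i a) (B a j) (C a j))
                               (∑-distrib-+ (λ a → A i a * B a j) (λ a → A i a * C a j))) ,
          (λ A B C i j → trans (sum-cong-≋ λ a → distribʳ (A a j) (B i a) (C i a))
                               (∑-distrib-+ (λ a → B i a * A a j) (λ a → C i a * A a j)))
      }
    }

  -- Block shears and the conjugating matrix.

  module _ {n r : ℕ} (U : Matrix n r) (V : Matrix r n) where

    private
      N = n + r
      module M = Ring (matrixRing N)
      open RingUnits (matrixRing N)

      -- Block functions take indices already split, so claims about blocks reduce to cases on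
      -- `inj₁` and `inj₂`.
      fromBlocks : (Fin n ⊎ Fin r → Fin n ⊎ Fin r → Carrier) → Matrix N N
      fromBlocks f i j = f (splitAt n i) (splitAt n j)

      upperBlock lowerBlock : Fin n ⊎ Fin r → Fin n ⊎ Fin r → Carrier
      upperBlock (inj₁ i) (inj₂ l) = U i l
      upperBlock (inj₁ _) (inj₁ _) = 0#
      upperBlock (inj₂ _) _        = 0#
      lowerBlock (inj₂ l) (inj₁ j) = V l j
      lowerBlock (inj₂ _) (inj₂ _) = 0#
      lowerBlock (inj₁ _) _        = 0#

      E F : Matrix N N
      E = fromBlocks upperBlock
      F = fromBlocks lowerBlock

      -- A nonzero entry of `E` has its row in the first block and its column in the second, so two
      -- of them never meet in a product.
      E·E≋0 : E · E ≋ M.0#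
      E·E≋0 i k = sum-zero λ j → vanish (splitAt n i) (splitAt n j) (splitAt n k)
        where
        vanish : ∀ a b c → upperBlock a b * upperBlock b c ≈ 0#
        vanish (inj₁ _) (inj₁ _) _ = zeroˡ _
        vanish (inj₁ _) (inj₂ _) _ = zeroʳ _
        vanish (inj₂ _) _        _ = zeroˡ _

      F·F≋0 : F · F ≋ M.0#
      F·F≋0 i k = sum-zero λ j → vanish (splitAt n i) (splitAt n j) (splitAt n k)
        where
        vanish : ∀ a b c → lowerBlock a b * lowerBlock b c ≈ 0#
        vanish (inj₂ _) (inj₂ _) _ = zeroˡ _
        vanish (inj₂ _) (inj₁ _) _ = zeroʳ _
        vanish (inj₁ _) _        _ = zeroˡ _

    P Q : Matrix N N
    P = (M.1# M.+ E) · (M.1# M.+ M.- F)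
    Q = (M.1# M.+ F) · (M.1# M.+ M.- E)

    -- The factors of `Q` are the inverses of those of `P` in reverse order: 1 + x and 1 - x are
    -- inverse when x squares to zero.
    P-inverse : Inverse P Q
    P-inverse =
      *-inverse ([1+x][1-x]≈1 E·E≋0) ([1-x][1+x]≈1 F·F≋0) ,
      *-inverse ([1+x][1-x]≈1 F·F≋0) ([1-x][1+x]≈1 E·E≋0)

    private
      -- Column `k` of 1 - X is that of the identity. This reduces the needed blocks of `P` and `Q`
      -- to those of their first factors.
      ·-[1-X] : ∀ (A X : Matrix N N) i k → (∀ j → X j k ≈ 0#) →
                (A · (M.1# M.+ M.- X)) i k ≈ A i k
      ·-[1-X] A X i k Xk≈0 = begin
        (A · (M.1# M.+ M.- X)) i k
          ≈⟨ sum-cong-≋ (λ j → *-congˡ {A i j} (trans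
               (+-congˡ {M.1# j k} (trans (-‿cong (Xk≈0 j)) -0#≈0#)) (+-identityʳ _))) ⟩
        (A · M.1#) i k
          ≈⟨ M.*-identityʳ A i k ⟩
        A i k ∎

      ↑ˡ≢↑ʳ : ∀ (i : Fin n) (l : Fin r) → i ↑ˡ r ≢ n ↑ʳ l
      ↑ˡ≢↑ʳ i l eq with () ← ≡.trans (≡.sym (splitAt-↑ˡ n i r))
                              (≡.trans (≡.cong (splitAt n) eq) (splitAt-↑ʳ n r l))

    -- The last `r` columns of `F` vanish, so only the factor 1 + E is seen.
    P-topRight : ∀ i l → P (i ↑ˡ r) (n ↑ʳ l) ≈ U i l
    P-topRight i l = begin
      P (i ↑ˡ r) (n ↑ʳ l)
        ≈⟨ ·-[1-X] (M.1# M.+ E) F (i ↑ˡ r) (n ↑ʳ l) (λ j → F-right (splitAt n j)) ⟩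
      M.1# (i ↑ˡ r) (n ↑ʳ l) ⊹ E (i ↑ˡ r) (n ↑ʳ l)
        ≈⟨ +-cong (diagonal-≢ _ _ _ (↑ˡ≢↑ʳ i l))
                  (reflexive (≡.cong₂ upperBlock (splitAt-↑ˡ n i r) (splitAt-↑ʳ n r l))) ⟩
      0# ⊹ U i l
        ≈⟨ +-identityˡ _ ⟩
      U i l ∎
      where
      F-right : ∀ a → lowerBlock a (splitAt n (n ↑ʳ l)) ≈ 0#
      F-right a rewrite splitAt-↑ʳ n r l with a
      ... | inj₁ _ = refl
      ... | inj₂ _ = refl

    -- The first `n` columns of `E` vanish, so only the factor 1 + F is seen.
    Q-bottomLeft : ∀ l j → Q (n ↑ʳ l) (j ↑ˡ r) ≈ V l j
    Q-bottomLeft l j = begin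
      Q (n ↑ʳ l) (j ↑ˡ r)
        ≈⟨ ·-[1-X] (M.1# M.+ F) E (n ↑ʳ l) (j ↑ˡ r) (λ i → E-left (splitAt n i)) ⟩
      M.1# (n ↑ʳ l) (j ↑ˡ r) ⊹ F (n ↑ʳ l) (j ↑ˡ r)
        ≈⟨ +-cong (diagonal-≢ _ _ _ (↑ˡ≢↑ʳ j l ∘ ≡.sym))
                  (reflexive (≡.cong₂ lowerBlock (splitAt-↑ʳ n r l) (splitAt-↑ˡ n j r))) ⟩
      0# ⊹ V l j
        ≈⟨ +-identityˡ _ ⟩
      V l j ∎
      where
      E-left : ∀ a → upperBlock a (splitAt n (j ↑ˡ r)) ≈ 0#
      E-left a rewrite splitAt-↑ˡ n j r with a
      ... | inj₁ _ = refl
      ... | inj₂ _ = refl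

    -- The `n` zeros keep the top-left block I - UV of `P` out of the corner of the conjugate.
    paddedDiagonal : Vector Carrier r → Matrix N N
    paddedDiagonal d = diagonal (replicate n 0# ++ d)

    conjugate-topLeft : ∀ d i j → (P · paddedDiagonal d · Q) (i ↑ˡ r) (j ↑ˡ r) ≈
                                  sum λ l → U i l * d l * V l j
    conjugate-topLeft d i j = begin
      (P · paddedDiagonal d · Q) i′ j′
        ≈⟨ sum-cong-≋ (λ m → *-congʳ {Q m j′} (·-diagonal P δ i′ m)) ⟩
      sum (λ m → P i′ m * δ m * Q m j′)
        ≈⟨ sum-split n _ ⟩
      sum (λ m → P i′ (m ↑ˡ r) * δ (m ↑ˡ r) * Q (m ↑ˡ r) j′) ⊹
      sum (λ l → P i′ (n ↑ʳ l) * δ (n ↑ʳ l) * Q (n ↑ʳ l) j′)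
        -- The first `n` terms meet the zero padding; the last `r` give U D V.
        ≈⟨ +-cong (sum-zero left) (sum-cong-≋ right) ⟩
      0# ⊹ sum (λ l → U i l * d l * V l j)
        ≈⟨ +-identityˡ _ ⟩
      sum (λ l → U i l * d l * V l j) ∎
      where
      i′ = i ↑ˡ r
      j′ = j ↑ˡ r
      δ : Vector Carrier N
      δ = replicate n 0# ++ d
      left : ∀ m → P i′ (m ↑ˡ r) * δ (m ↑ˡ r) * Q (m ↑ˡ r) j′ ≈ 0#
      left m = begin
        P i′ (m ↑ˡ r) * δ (m ↑ˡ r) * Q (m ↑ˡ r) j′
          ≡⟨ ≡.cong (λ s → P i′ (m ↑ˡ r) * [ replicate n 0# , d ] s * Q (m ↑ˡ r) j′)
                    (splitAt-↑ˡ n m r) ⟩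
        P i′ (m ↑ˡ r) * 0# * Q (m ↑ˡ r) j′
          ≈⟨ *-congʳ (zeroʳ _) ⟩
        0# * Q (m ↑ˡ r) j′
          ≈⟨ zeroˡ _ ⟩
        0# ∎
      right : ∀ l → P i′ (n ↑ʳ l) * δ (n ↑ʳ l) * Q (n ↑ʳ l) j′ ≈ U i l * d l * V l j
      right l = *-cong
        (*-cong (P-topRight i l)
                (reflexive (≡.cong [ replicate n 0# , d ] (splitAt-↑ʳ n r l))))
        (Q-bottomLeft l j)

  -- From rank decompositions to commuting extensions.

  inject≤≡↑ˡ : ∀ {n} r (i : Fin n) → inject≤ i (ℕ.m≤m+n n r) ≡ i ↑ˡ r
  inject≤≡↑ˡ {n} r i =
    toℕ-injective (≡.trans (toℕ-inject≤ i (ℕ.m≤m+n n r)) (≡.sym (toℕ-↑ˡ i r)))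

  -- The size `N` is a parameter of its own so that `n + r` can later be exchanged for `r + n`.
  CommutingExtension : ∀ {n p} → (Fin p → Matrix n n) → ℕ → Set _
  CommutingExtension {p = p} A N = ∃ λ (Z : Fin p → Matrix N N) →
    PairwiseCommuting Z × (∀ i → Diagonalizable (Z i)) × (∀ i → EmbeddedIn (A i) (Z i))

  -- `P` depends on `U` and `V` alone, so one conjugation diagonalizes the whole family at once, and
  -- its members commute.
  simultaneousFactorization⇒extension :
    ∀ {n r p} (A : Fin p → Matrix n n) (U : Matrix n r) (V : Matrix r n)
    (d : Fin p → Vector Carrier r) →
    (∀ k i j → A k i j ≈ sum λ l → U i l * d k l * V l j) →
    CommutingExtension A (n + r)
  simultaneousFactorization⇒extension {n} {r} A U V d A≈UdV =
    (λ k → P U V · D k · Q U V) ,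
    (λ k l → conjugates-commute {P U V} {Q U V} {D k} {D l}
               (proj₂ (P-inverse U V)) (diagonals-commute _ _)) ,
    (λ k → P U V , Q U V , D k , P-inverse U V , diagonal-≢ _ , λ _ _ → refl) ,
    (λ k → ℕ.m≤m+n n r , embedded k)
    where
    open RingUnits (matrixRing (n + r)) using (conjugates-commute)
    D = λ k → paddedDiagonal U V (d k)
    embedded : ∀ k i j → (P U V · D k · Q U V) (inject≤ i (ℕ.m≤m+n n r)) (inject≤ j (ℕ.m≤m+n n r))
                         ≈ A k i j
    -- `EmbeddedIn` addresses the corner by `inject≤`, the block computation by `↑ˡ`.
    embedded k i j rewrite inject≤≡↑ˡ r i | inject≤≡↑ˡ r j =
      trans (conjugate-topLeft U V (d k) i j) (sym (A≈UdV k i j))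

  sumOfRankOnes⇒extension :
    ∀ {n r p} (A : Fin p → Matrix n n) (T : Tensor n n p) →
    (∀ k → zSlice T k ≋ A k) → SumOfRankOnes T r → CommutingExtension A (n + r)
  sumOfRankOnes⇒extension {n} {r} {p} A T slices (S , rankOne , T≈S) =
    simultaneousFactorization⇒extension A
      (λ i l → u l i) (λ l j → v l j) (λ k l → w l k) λ k i j → begin
        A k i j                            ≈⟨ slices k i j ⟨
        T i j k                            ≈⟨ T≈S i j k ⟩
        sum (λ l → S l i j k)              ≈⟨ sum-cong-≋ (λ l → S≈u⊗v⊗w l i j k) ⟩
        -- Moving the coordinate of `w` to the middle makes it the diagonal entry between `U` and
        -- `V`.
        sum (λ l → u l i * v l j * w l k)  ≈⟨ sum-cong-≋ (λ l → xy∙z≈xz∙y (u l i) (v l j) (w l k)) ⟩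
        sum (λ l → u l i * w l k * v l j)  ∎
    where
    open import Algebra.Properties.CommutativeSemigroup *-commutativeSemigroup using (xy∙z≈xz∙y)
    u v : Fin r → Vector Carrier n
    u l = proj₁ (rankOne l)
    v l = proj₁ (proj₂ (rankOne l))
    w : Fin r → Vector Carrier p
    w l = proj₁ (proj₂ (proj₂ (rankOne l)))
    S≈u⊗v⊗w : ∀ l → S l ≈ᵀ (u l ⊗ v l ⊗ w l)
    S≈u⊗v⊗w l = proj₂ (proj₂ (proj₂ (proj₂ (proj₂ (proj₂ (rankOne l))))))

theorem2 : ∀ {k} (K : Subfield ℂ-commutativeRing k) →
    let open LinearAlgebra (Subfield.commutativeRing K) in
    (n p : ℕ) (A : Fin p → Matrix n n) (T : Tensor n n p) →
    (∀ i → zSlice T i ≋ A i) →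
    (r : ℕ) → HasRank T r →
    ∃ λ (Z : Fin p → Matrix (r + n) (r + n)) →
    PairwiseCommuting Z ×
    (∀ i → Diagonalizable (Z i)) ×
    (∀ i → EmbeddedIn (A i) (Z i))
theorem2 K n p A T slices r (sumOfRankOnes , _) =
  -- The block of size `n` comes first in the construction, giving size `n + r`; the transport
  -- rewrites only the size, and the corner stays at the top left.
  ≡.subst (CommutingExtension A) (ℕ.+-comm n r)
    (sumOfRankOnes⇒extension A T slices sumOfRankOnes)
  where open Matrices (Subfield.commutativeRing K)
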